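{- (RDR edge switching) Let $X$ be a $d$-RDR graph and let $f$ be a $d$-RDR coloring function on $X$. Suppose that $e_1=\{u_1,v_1\}$ and $e_2=\{u_2,v_2\}\in E(X)$ are two edges with endpoints of same color: $f(u_1)=f(u_2)\neq\emptyset$ (implying $f(v_1)=f(v_2)=\emptyset$). Construct the graph $X'$ with the same vertex set $V(X')=V(X)$ and edge set $E(X')=(E(X)\cup\{e_1',e_2'\})\setminus\{e_1,e_2\}$, where $e_1'=\{u_1,v_2\}$ and $e_2'=\{u_2,v_1\}$. Then $X'$ is a $d$-RDR graph with a $d$-RDR coloring function $f'=f$.
   Context: All graphs are finite and simple, and $d$ is a positive integer. For a graph $G=(V,E)$, $N(v)$ is the open neighbourhood of $v$. Let $\mathcal K=\{1,\dots,k\}$. A $k$-rainbow dominating function ($k$-RDF) on $G$ is a map $f\colon V\to 2^{\mathcal K}$ such that $f(v)=\emptyset$ implies $\bigcup_{u\in N(v)}f(u)=\mathcal K$, for all $v\in V$. Its weight is $w(f)=\sum_{v\in V}|f(v)|$, and the $k$-rainbow domination number $\gamma_{rk}(G)$ is the minimum weight of a $k$-RDF on $G$. It is known that a $d$-regular graph $G$ of order $n$ satisfies $\gamma_{rd}(G)\ge n/2$. A $d$-regular graph $G$ of order $n$ is called $d$-rainbow domination regular ($d$-RDR) if $\gamma_{rd}(G)=n/2$. A $d$-RDR coloring function on a $d$-RDR graph is a $d$-RDF of minimum weight $n/2$. It is known that for such a function the sets of colored vertices ($f(v)\ne\emptyset$) and non-colored vertices ($f(v)=\emptyset$) form a bipartition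 of the graph into sets of size $n/2$, and each colored vertex receives exactly one color.
   Formalization: The condition u₁ ≠ u₂ is added: if u₁ = u₂, then {e₁′, e₂′} = {e₁, e₂}, so the stated edge set only deletes edges and X′ is not d-regular (for example, two edges at a coloured vertex of C₄ with d = 2). -}

module Defs where

open import Algebra.Properties.CommutativeMonoid.Sum using (sum)
open import Data.Fin using (Fin)
open import Data.Fin.Subset using (Subset; ⊥; ⊤; ⋃; ∣_∣)
open import Data.List using (List; allFin; filter; length; map)
open import Data.Nat using (ℕ; _*_; _≤_)
open import Data.Nat.Properties using (+-0-commutativeMonoid)
open import Data.Product using (_×_; ∃-syntax)
open import Data.Sum using (_⊎_)
open import Function using (_⇔_)
open import Level using (0ℓ)
open import Relation.Binary
  using (Rel; Decidable; Symmetric; Irreflexive)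
open import Relation.Binary.PropositionalEquality using (_≡_)
open import Relation.Nullary using (¬_)

-- Finite simple graphs on the vertex set Fin n.  Decidability of adjacency
-- is part of what makes the edge set finite; it lets N(v) be enumerated.
record Graph (n : ℕ) : Set₁ where
  field
    Adj    : Rel (Fin n) 0ℓ
    adj?   : Decidable Adj
    sym    : Symmetric Adj
    irrefl : Irreflexive _≡_ Adj

  N : Fin n → List (Fin n)
  N v = filter (adj? v) (allFin n)

open Graph public using (Adj; N)

Regular : ∀ {n} → ℕ → Graph n → Set
Regular d G = ∀ v → length (N G v) ≡ d

-- Fin k is the set of colours, so a map V → 2^𝒦 is a Coloring n k.
Coloring : ℕ → ℕ → Set
Coloring n k = Fin n → Subset k

IsRDF : ∀ {n} (k : ℕ) → Graph n → Coloring n k → Set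
IsRDF k G f = ∀ v → f v ≡ ⊥ → ⋃ (map f (N G v)) ≡ ⊤

weight : ∀ {n k} → Coloring n k → ℕ
weight f = sum +-0-commutativeMonoid (λ v → ∣ f v ∣)

-- γ[ k , G ]≡ m : the minimum weight of a k-RDF on G exists and equals m.
γ[_,_]≡_ : ∀ {n} → ℕ → Graph n → ℕ → Set
γ[_,_]≡_ {n} k G m =
  (∃[ f ] IsRDF k G f × weight f ≡ m)
  × (∀ (f : Coloring n k) → IsRDF k G f → m ≤ weight f)

-- The condition γ = n/2 is an equality of rationals: it forces n to be even,
-- so it is written 2 * γ ≡ n rather than with truncating division.
IsRDR : ∀ {n} → ℕ → Graph n → Set
IsRDR {n} d G = Regular d G × (∃[ m ] (γ[ d , G ]≡ m) × 2 * m ≡ n)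

IsRDRColoring : ∀ {n} (d : ℕ) → Graph n → Coloring n d → Set
IsRDRColoring {n} d G f =
  IsRDF d G f × (γ[ d , G ]≡ weight f) × 2 * weight f ≡ n

-- Equality of the unordered pairs {x, y} and {a, b}.
infix 4 ⟅_,_⟆≡⟅_,_⟆
⟅_,_⟆≡⟅_,_⟆ : ∀ {n} → Fin n → Fin n → Fin n → Fin n → Set
⟅ x , y ⟆≡⟅ a , b ⟆ = (x ≡ a × y ≡ b) ⊎ (x ≡ b × y ≡ a)

-- G′ has edge set (E(G) ∪ {{u₁,v₂}, {u₂,v₁}}) \ {{u₁,v₁}, {u₂,v₂}}.
-- This determines the edge set of G′ uniquely.
IsEdgeSwitch : ∀ {n} → Graph n → (u₁ v₁ u₂ v₂ : Fin n) → Graph n → Set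
IsEdgeSwitch G u₁ v₁ u₂ v₂ G′ = ∀ x y →
  Adj G′ x y ⇔
    ( (Adj G x y ⊎ ⟅ x , y ⟆≡⟅ u₁ , v₂ ⟆ ⊎ ⟅ x , y ⟆≡⟅ u₂ , v₁ ⟆)
    × ¬ ⟅ x , y ⟆≡⟅ u₁ , v₁ ⟆
    × ¬ ⟅ x , y ⟆≡⟅ u₂ , v₂ ⟆ )

{-# OPTIONS --safe #-}
-- For a d-RDF f put load v = Σ_{u ∈ N(v)} |f u|.  Every vertex satisfies
-- d ≤ load v + d |f v|, and in a d-regular graph the right-hand sides sum to
-- 2 d w(f).  Hence n ≤ 2 w(f), and when n = 2 w(f) all these inequalities are
-- equalities: coloured vertices have only non-coloured neighbours, and no two
-- neighbours of a non-coloured vertex share a colour.  In particular v₁ ≠ v₂,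
-- and neither {u₁, v₂} nor {u₂, v₁} is an edge.  So switching replaces the
-- neighbourhood of each vertex by its image under a transposition that
-- preserves f, which keeps both regularity and the domination property.
module Submission where

open import Defs
open import Algebra.Properties.CommutativeMonoid.Sum
  using (sum; sum-cong-≗; sum-permute; ∑-comm; ∑-distrib-+)
open import Algebra.Properties.Semiring.Sum using (*-distribˡ-sum)
open import Data.Bool using (if_then_else_)
open import Data.Fin using (Fin; zero; suc; _≟_)
open import Data.Fin.Permutation as Perm
  using (Permutation′; _⟨$⟩ʳ_; _⟨$⟩ˡ_; inverseʳ)
open import Data.Fin.Permutation.Components using (transpose)
open import Data.Fin.Subset using (Subset; Nonempty; inside; outside; _∪_; ⊥; ⊤; ⋃; ∣_∣; _⊆_)
  renaming (_∈_ to _∈ˢ_)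
open import Data.Fin.Subset.Properties
  using ( nonempty?; Empty-unique; x∈p⇒∣p-x∣<∣p∣; ∣⊥∣≡0; ∣⊤∣≡n; ∈⊤; ∉⊥; ⊆⊤
        ; ⊆-antisym; x∈p∪q⁺; x∈p∪q⁻; p⊆q⇒∣p∣≤∣q∣ )
open import Data.List using (List; []; _∷_; allFin; filter; length; map; tabulate)
open import Data.List.Membership.Propositional using (_∈_)
open import Data.List.Membership.Propositional.Properties
  using (∈-allFin; ∈-filter⁺; ∈-filter⁻)
open import Data.List.Relation.Unary.Any using (here; there)
import Data.Nat.ListAction as List
open import Data.Nat
  using (ℕ; zero; suc; NonZero; _+_; _*_; _≤_; _<_; z≤n; s≤s; >-nonZero)
open import Data.Nat.Properties hiding (_≟_)
open import Data.Product using (_×_; _,_; Σ-syntax; ∃-syntax; proj₂)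
open import Data.Sum using (_⊎_; inj₁; inj₂; swap)
open import Data.Vec using ([]; _∷_)
open import Function using (_∘_; id; _⇔_; mk⇔; Equivalence)
open import Function.Construct.Composition using (_⇔-∘_)
open import Function.Construct.Identity using (⇔-id)
open import Level using (0ℓ)
open import Relation.Binary.PropositionalEquality
  using (_≡_; _≢_; refl; sym; trans; cong; cong₂; subst; module ≡-Reasoning)
open import Relation.Nullary using (¬_; Dec; yes; no; does; contradiction; ¬?; _×-dec_; _⊎-dec_)
open import Relation.Nullary.Decidable using (does-⇔)
open import Relation.Unary using (Pred; Decidable)

private
  variable
    n k d : ℕ

  ∑ : (Fin n → ℕ) → ℕ
  ∑ = sum +-0-commutativeMonoid

-- Sums over Fin n

∑-const : ∀ n c → ∑ {n} (λ _ → c) ≡ n * c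
∑-const zero    c = refl
∑-const (suc n) c = cong (c +_) (∑-const n c)

∑-mono : {a b : Fin n → ℕ} → (∀ i → a i ≤ b i) → ∑ a ≤ ∑ b
∑-mono {zero}  a≤b = z≤n
∑-mono {suc n} a≤b = +-mono-≤ (a≤b zero) (∑-mono (a≤b ∘ suc))

-- A strict gap at one index cannot be made up at the others. This turns the single equality
-- `2 * weight f ≡ n` into information at each vertex.
∑-mono-tight : {a b : Fin n → ℕ} → (∀ i → a i ≤ b i) → ∑ b ≤ ∑ a → ∀ i → b i ≤ a i
∑-mono-tight {suc n} {a} {b} a≤b ∑b≤∑a zero =
  +-cancelʳ-≤ (∑ (b ∘ suc)) (b zero) (a zero)
    (≤-trans ∑b≤∑a (+-monoʳ-≤ (a zero) (∑-mono (a≤b ∘ suc))))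
∑-mono-tight {suc n} {a} {b} a≤b ∑b≤∑a (suc i) =
  ∑-mono-tight (a≤b ∘ suc)
    (+-cancelˡ-≤ (b zero) _ _ (≤-trans ∑b≤∑a (+-monoˡ-≤ _ (a≤b zero)))) i

-- Passing from neighbourhood lists to indicator sums makes exchange of summation and reindexing by
-- permutations available. The map `h` is general because the induction replaces it by `h ∘ suc`.
sum-filter-tabulate : {A : Set} {P : Pred A 0ℓ} (P? : Decidable P) (g : A → ℕ) (h : Fin n → A) →
  List.sum (map g (filter P? (tabulate h))) ≡ ∑ (λ i → if does (P? (h i)) then g (h i) else 0)
sum-filter-tabulate {zero}  P? g h = refl
sum-filter-tabulate {suc n} P? g h with P? (h zero)
... | yes _ = cong (g (h zero) +_) (sum-filter-tabulate P? g (h ∘ suc))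
... | no  _ = sum-filter-tabulate P? g (h ∘ suc)

sum-map-const : {A : Set} (c : ℕ) (xs : List A) → List.sum (map (λ _ → c) xs) ≡ length xs * c
sum-map-const c []       = refl
sum-map-const c (_ ∷ xs) = cong (c +_) (sum-map-const c xs)

-- Cardinalities of subsets and unions

Nonempty⇒0<∣p∣ : {p : Subset k} → Nonempty p → 0 < ∣ p ∣
Nonempty⇒0<∣p∣ (_ , x∈p) = ≤-<-trans z≤n (x∈p⇒∣p-x∣<∣p∣ x∈p)

∣p∣≤0⇒p≡⊥ : {p : Subset k} → ∣ p ∣ ≤ 0 → p ≡ ⊥
∣p∣≤0⇒p≡⊥ {p = p} ∣p∣≤0 = Empty-unique (λ ne → <⇒≱ (Nonempty⇒0<∣p∣ ne) ∣p∣≤0)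

p≢⊥⇒0<∣p∣ : {p : Subset k} → p ≢ ⊥ → 0 < ∣ p ∣
p≢⊥⇒0<∣p∣ p≢⊥ = ≰⇒> (p≢⊥ ∘ ∣p∣≤0⇒p≡⊥)

∣p∪q∣≤∣p∣+∣q∣ : (p q : Subset k) → ∣ p ∪ q ∣ ≤ ∣ p ∣ + ∣ q ∣
∣p∪q∣≤∣p∣+∣q∣ []            []            = z≤n
∣p∪q∣≤∣p∣+∣q∣ (outside ∷ p) (outside ∷ q) = ∣p∪q∣≤∣p∣+∣q∣ p q
∣p∪q∣≤∣p∣+∣q∣ (outside ∷ p) (inside  ∷ q) =
  ≤-trans (s≤s (∣p∪q∣≤∣p∣+∣q∣ p q)) (≤-reflexive (sym (+-suc ∣ p ∣ ∣ q ∣)))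
∣p∪q∣≤∣p∣+∣q∣ (inside  ∷ p) (outside ∷ q) = s≤s (∣p∪q∣≤∣p∣+∣q∣ p q)
∣p∪q∣≤∣p∣+∣q∣ (inside  ∷ p) (inside  ∷ q) =
  s≤s (≤-trans (∣p∪q∣≤∣p∣+∣q∣ p q) (+-monoʳ-≤ ∣ p ∣ (n≤1+n ∣ q ∣)))

module _ {A : Set} (f : A → Subset k) where

  ∈-⋃⁺ : ∀ {c x xs} → x ∈ xs → c ∈ˢ f x → c ∈ˢ ⋃ (map f xs)
  ∈-⋃⁺ (here refl)  c∈ = x∈p∪q⁺ (inj₁ c∈)
  ∈-⋃⁺ (there x∈xs) c∈ = x∈p∪q⁺ (inj₂ (∈-⋃⁺ x∈xs c∈))

  ∈-⋃⁻ : ∀ {c} xs → c ∈ˢ ⋃ (map f xs) → ∃[ x ] x ∈ xs × c ∈ˢ f x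
  ∈-⋃⁻ []       c∈ = contradiction c∈ ∉⊥
  ∈-⋃⁻ (x ∷ xs) c∈ with x∈p∪q⁻ (f x) _ c∈
  ... | inj₁ c∈fx = x , here refl , c∈fx
  ... | inj₂ c∈⋃  with y , y∈xs , c∈fy ← ∈-⋃⁻ xs c∈⋃ = y , there y∈xs , c∈fy

  ∣⋃∣≤sum : ∀ xs → ∣ ⋃ (map f xs) ∣ ≤ List.sum (map (∣_∣ ∘ f) xs)
  ∣⋃∣≤sum []       = ≤-reflexive (∣⊥∣≡0 k)
  ∣⋃∣≤sum (x ∷ xs) =
    ≤-trans (∣p∪q∣≤∣p∣+∣q∣ (f x) _) (+-monoʳ-≤ ∣ f x ∣ (∣⋃∣≤sum xs))

  ∈⇒∣f∣≤sum : ∀ {x xs} → x ∈ xs → ∣ f x ∣ ≤ List.sum (map (∣_∣ ∘ f) xs)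
  ∈⇒∣f∣≤sum (here refl)  = m≤m+n _ _
  ∈⇒∣f∣≤sum (there x∈xs) = ≤-trans (∈⇒∣f∣≤sum x∈xs) (m≤n+m _ _)

  private
    -- The head adds nothing to the union, since `y` in the tail already supplies its colours.
    absorb : ∀ {x y xs} → y ∈ xs → f x ≡ f y →
      ∣ f x ∣ + ∣ ⋃ (map f (x ∷ xs)) ∣ ≤ List.sum (map (∣_∣ ∘ f) (x ∷ xs))
    absorb {x} {y} {xs} y∈xs fx≡fy = +-monoʳ-≤ ∣ f x ∣ (≤-trans (p⊆q⇒∣p∣≤∣q∣ ⊆⋃) (∣⋃∣≤sum xs))
      where
      ⊆⋃ : f x ∪ ⋃ (map f xs) ⊆ ⋃ (map f xs)
      ⊆⋃ c∈ with x∈p∪q⁻ (f x) _ c∈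
      ... | inj₁ c∈fx = ∈-⋃⁺ y∈xs (subst (_ ∈ˢ_) fx≡fy c∈fx)
      ... | inj₂ c∈⋃  = c∈⋃

  -- A set occurring at two places is counted twice by the sum but only once by the union, which
  -- leaves a surplus of its cardinality.
  ∣f∣+∣⋃∣≤sum : ∀ {x y xs} → x ∈ xs → y ∈ xs → x ≢ y → f x ≡ f y →
    ∣ f x ∣ + ∣ ⋃ (map f xs) ∣ ≤ List.sum (map (∣_∣ ∘ f) xs)
  ∣f∣+∣⋃∣≤sum (here refl) (here refl) x≢y _     = contradiction refl x≢y
  ∣f∣+∣⋃∣≤sum (here refl) (there y∈)  _   fx≡fy = absorb y∈ fx≡fy
  ∣f∣+∣⋃∣≤sum {xs = _ ∷ xs} (there x∈) (here refl) _ fx≡fy =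
    subst (λ p → ∣ p ∣ + ∣ ⋃ (map f (_ ∷ xs)) ∣ ≤ List.sum (map (∣_∣ ∘ f) (_ ∷ xs)))
      (sym fx≡fy) (absorb x∈ (sym fx≡fy))
  -- Both occurrences lie in the tail: the head is split off by subadditivity and the surplus comes
  -- from the induction hypothesis.
  ∣f∣+∣⋃∣≤sum {x} {xs = z ∷ zs} (there x∈) (there y∈) x≢y fx≡fy = begin
    ∣ f x ∣ + ∣ f z ∪ ⋃ (map f zs) ∣
      ≤⟨ +-monoʳ-≤ ∣ f x ∣ (∣p∪q∣≤∣p∣+∣q∣ (f z) _) ⟩
    ∣ f x ∣ + (∣ f z ∣ + ∣ ⋃ (map f zs) ∣)
      ≡⟨ +-assoc ∣ f x ∣ _ _ ⟨
    ∣ f x ∣ + ∣ f z ∣ + ∣ ⋃ (map f zs) ∣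
      ≡⟨ cong (_+ ∣ ⋃ (map f zs) ∣) (+-comm ∣ f x ∣ _) ⟩
    ∣ f z ∣ + ∣ f x ∣ + ∣ ⋃ (map f zs) ∣
      ≡⟨ +-assoc ∣ f z ∣ _ _ ⟩
    ∣ f z ∣ + (∣ f x ∣ + ∣ ⋃ (map f zs) ∣)
      ≤⟨ +-monoʳ-≤ ∣ f z ∣ (∣f∣+∣⋃∣≤sum x∈ y∈ x≢y fx≡fy) ⟩
    ∣ f z ∣ + List.sum (map (∣_∣ ∘ f) zs) ∎
    where open ≤-Reasoning

-- Rainbow domination in regular graphs

module _ (G : Graph n) where
  open Graph G using (adj?) renaming (sym to adj-sym)

  Adj⇒∈N : ∀ {x y} → Adj G x y → y ∈ N G x
  Adj⇒∈N {x} {y} = ∈-filter⁺ (adj? x) (∈-allFin y)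

  ∈N⇒Adj : ∀ {x y} → y ∈ N G x → Adj G x y
  ∈N⇒Adj {x} = proj₂ ∘ ∈-filter⁻ (adj? x) {xs = allFin n}

  length-N : ∀ x → length (N G x) ≡ ∑ (λ y → if does (adj? x y) then 1 else 0)
  length-N x = begin
    length (N G x)                       ≡⟨ *-identityʳ _ ⟨
    length (N G x) * 1                   ≡⟨ sum-map-const 1 (N G x) ⟨
    List.sum (map (λ _ → 1) (N G x))     ≡⟨ sum-filter-tabulate (adj? x) (λ _ → 1) id ⟩
    ∑ (λ y → if does (adj? x y) then 1 else 0) ∎
    where open ≡-Reasoning

  load : Coloring n k → Fin n → ℕ
  load f v = List.sum (map (∣_∣ ∘ f) (N G v))

  -- Double counting: each `u` contributes `∣ f u ∣` to the load of each of its `d` neighbours.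
  ∑-load : Regular d G → (f : Coloring n k) → ∑ (load f) ≡ d * weight f
  ∑-load {d = d} reg f = begin
    ∑ (load f)
      ≡⟨ sum-cong-≗ M (λ v → sum-filter-tabulate (adj? v) (∣_∣ ∘ f) id) ⟩
    ∑ (λ v → ∑ λ u → if does (adj? v u) then ∣ f u ∣ else 0)
      ≡⟨ ∑-comm M {n} {n} (λ v u → if does (adj? v u) then ∣ f u ∣ else 0) ⟩
    ∑ (λ u → ∑ λ v → if does (adj? v u) then ∣ f u ∣ else 0)
      -- Symmetry of adjacency turns the inner sum into a sum over the neighbourhood of `u`, where
      -- the summand is constant.
      ≡⟨ sum-cong-≗ M (λ u → sum-cong-≗ M λ v → cong (if_then ∣ f u ∣ else 0)
           (does-⇔ (mk⇔ adj-sym adj-sym) (adj? v u) (adj? u v))) ⟩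
    ∑ (λ u → ∑ λ v → if does (adj? u v) then ∣ f u ∣ else 0)
      ≡⟨ sum-cong-≗ M (λ u → sum-filter-tabulate (adj? u) (λ _ → ∣ f u ∣) id) ⟨
    ∑ (λ u → List.sum (map (λ _ → ∣ f u ∣) (N G u)))
      ≡⟨ sum-cong-≗ M (λ u → trans (sum-map-const ∣ f u ∣ (N G u)) (cong (_* ∣ f u ∣) (reg u))) ⟩
    ∑ (λ u → d * ∣ f u ∣)
      ≡⟨ *-distribˡ-sum +-*-semiring d (∣_∣ ∘ f) ⟨
    d * weight f ∎
    where
    open ≡-Reasoning
    M = +-0-commutativeMonoid

  module _ (f : Coloring n d) where

    ⊥⇒d≤load : IsRDF d G f → ∀ v → f v ≡ ⊥ → d ≤ load f v
    ⊥⇒d≤load rdf v fv≡⊥ = begin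
      d                       ≡⟨ ∣⊤∣≡n d ⟨
      ∣ ⊤ {d} ∣                 ≡⟨ cong ∣_∣ (rdf v fv≡⊥) ⟨
      ∣ ⋃ (map f (N G v)) ∣   ≤⟨ ∣⋃∣≤sum f (N G v) ⟩
      load f v                ∎
      where open ≤-Reasoning

    coloured⇒d≤d*∣f∣ : ∀ {v} → 0 < ∣ f v ∣ → d ≤ d * ∣ f v ∣
    coloured⇒d≤d*∣f∣ {v} 0<∣fv∣ = m≤m*n d ∣ f v ∣ {{>-nonZero 0<∣fv∣}}

    -- The factor `d` makes one colour at `v` enough. Without a colour at `v`, its neighbours must
    -- supply all `d` colours.
    d≤load+d*∣f∣ : IsRDF d G f → ∀ v → d ≤ load f v + d * ∣ f v ∣
    d≤load+d*∣f∣ rdf v with nonempty? (f v)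
    ... | yes ne = ≤-trans (coloured⇒d≤d*∣f∣ (Nonempty⇒0<∣p∣ ne)) (m≤n+m _ _)
    ... | no ¬ne = ≤-trans (⊥⇒d≤load rdf v (Empty-unique ¬ne)) (m≤m+n _ _)

    ∑-load+d*∣f∣ : Regular d G → ∑ (λ v → load f v + d * ∣ f v ∣) ≡ (2 * weight f) * d
    ∑-load+d*∣f∣ reg = begin
      ∑ (λ v → load f v + d * ∣ f v ∣)
        ≡⟨ ∑-distrib-+ +-0-commutativeMonoid (load f) (λ v → d * ∣ f v ∣) ⟩
      ∑ (load f) + ∑ (λ v → d * ∣ f v ∣)
        ≡⟨ cong₂ _+_ (∑-load reg f) (sym (*-distribˡ-sum +-*-semiring d (∣_∣ ∘ f))) ⟩
      d * weight f + d * weight f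
        ≡⟨ *-distribˡ-+ d (weight f) (weight f) ⟨
      d * (weight f + weight f)
        ≡⟨ cong (λ w → d * (weight f + w)) (+-identityʳ (weight f)) ⟨
      d * (2 * weight f)
        ≡⟨ *-comm d (2 * weight f) ⟩
      (2 * weight f) * d ∎
      where open ≡-Reasoning

    -- The general bound of n/2, obtained by summing the local inequality over all vertices and
    -- cancelling `d`.
    n≤2*weight : .{{_ : NonZero d}} → Regular d G → IsRDF d G f → n ≤ 2 * weight f
    n≤2*weight reg rdf = *-cancelʳ-≤ n (2 * weight f) d (begin
      n * d                              ≡⟨ ∑-const n d ⟨
      ∑ {n} (λ _ → d)                    ≤⟨ ∑-mono (d≤load+d*∣f∣ rdf) ⟩
      ∑ (λ v → load f v + d * ∣ f v ∣)   ≡⟨ ∑-load+d*∣f∣ reg ⟩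
      2 * weight f * d                   ∎)
      where open ≤-Reasoning

    module Tight (reg : Regular d G) (rdf : IsRDF d G f) (2w≡n : 2 * weight f ≡ n) where

      -- Both sides of the local inequality have total `n * d`, so there is no slack at any vertex.
      load+d*∣f∣≤d : ∀ v → load f v + d * ∣ f v ∣ ≤ d
      load+d*∣f∣≤d = ∑-mono-tight (d≤load+d*∣f∣ rdf) (≤-reflexive (begin
        ∑ (λ v → load f v + d * ∣ f v ∣)   ≡⟨ ∑-load+d*∣f∣ reg ⟩
        2 * weight f * d                   ≡⟨ cong (_* d) 2w≡n ⟩
        n * d                              ≡⟨ ∑-const n d ⟨
        ∑ {n} (λ _ → d)                    ∎))
        where open ≡-Reasoning

      -- The term `d * ∣ f u ∣` alone uses up the budget `d`, so the load of `u` is zero.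
      coloured⇒neighbour-⊥ : ∀ {u v} → Adj G u v → f u ≢ ⊥ → f v ≡ ⊥
      coloured⇒neighbour-⊥ {u} {v} u~v fu≢⊥ = ∣p∣≤0⇒p≡⊥ (≤-trans
        (∈⇒∣f∣≤sum f (Adj⇒∈N u~v))
        (+-cancelʳ-≤ d (load f u) 0 (≤-trans
          (+-monoʳ-≤ (load f u) (coloured⇒d≤d*∣f∣ (p≢⊥⇒0<∣p∣ fu≢⊥)))
          (load+d*∣f∣≤d u))))

      -- The neighbours of `v` must cover all `d` colours with total load at most `d`; a repeated
      -- nonempty set would push the load above `d`.
      same-colour-neighbours : ∀ {x y v} → Adj G v x → Adj G v y →
        f v ≡ ⊥ → f x ≡ f y → f x ≢ ⊥ → x ≡ y
      same-colour-neighbours {x} {y} {v} v~x v~y fv≡⊥ fx≡fy fx≢⊥ with x ≟ y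
      ... | yes x≡y = x≡y
      ... | no  x≢y = contradiction (begin-strict
        d                                 <⟨ +-monoˡ-≤ d (p≢⊥⇒0<∣p∣ fx≢⊥) ⟩
        ∣ f x ∣ + d                       ≡⟨ cong (∣ f x ∣ +_) (∣⊤∣≡n d) ⟨
        ∣ f x ∣ + ∣ ⊤ {d} ∣               ≡⟨ cong (λ p → ∣ f x ∣ + ∣ p ∣) (rdf v fv≡⊥) ⟨
        ∣ f x ∣ + ∣ ⋃ (map f (N G v)) ∣   ≤⟨ ∣f∣+∣⋃∣≤sum f (Adj⇒∈N v~x) (Adj⇒∈N v~y) x≢y fx≡fy ⟩
        load f v                          ≤⟨ m≤m+n _ _ ⟩
        load f v + d * ∣ f v ∣            ≤⟨ load+d*∣f∣≤d v ⟩
        d                                 ∎) (<-irrefl refl)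
        where open ≤-Reasoning

-- Such an `f` attains the general lower bound, so minimality in the switched graph needs no
-- comparison with the original one.
tight⇒minimal : .{{_ : NonZero d}} (G : Graph n) (f : Coloring n d) →
  Regular d G → IsRDF d G f → 2 * weight f ≡ n → γ[ d , G ]≡ weight f
tight⇒minimal G f reg rdf 2w≡n = (f , rdf , refl) , λ g g-rdf →
  *-cancelˡ-≤ 2 (≤-trans (≤-reflexive 2w≡n) (n≤2*weight G g reg g-rdf))

-- Permuted neighbourhoods

-- The permutation may depend on `x`, so this is weaker than an isomorphism: neighbourhoods
-- correspond one at a time.
PermutedN : (f : Coloring n k) (G G′ : Graph n) → Set
PermutedN {n} f G G′ = ∀ x → Σ[ π ∈ Permutation′ n ]
  (∀ y → f (π ⟨$⟩ʳ y) ≡ f y) × (∀ y → Adj G′ x y ⇔ Adj G x (π ⟨$⟩ʳ y))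

module _ {f : Coloring n k} {G G′ : Graph n} (perm : PermutedN f G G′) where

  permuted-Regular : Regular d G → Regular d G′
  permuted-Regular {d = d} reg x with π , _ , G′⇔G ← perm x = begin
    length (N G′ x)
      ≡⟨ length-N G′ x ⟩
    ∑ (λ y → if does (Graph.adj? G′ x y) then 1 else 0)
      ≡⟨ sum-cong-≗ M (λ y → cong (if_then 1 else 0)
           (does-⇔ (G′⇔G y) (Graph.adj? G′ x y) (Graph.adj? G x (π ⟨$⟩ʳ y)))) ⟩
    ∑ (λ y → if does (Graph.adj? G x (π ⟨$⟩ʳ y)) then 1 else 0)
      ≡⟨ sum-permute M (λ y → if does (Graph.adj? G x y) then 1 else 0) π ⟨
    ∑ (λ y → if does (Graph.adj? G x y) then 1 else 0)
      ≡⟨ length-N G x ⟨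
    length (N G x)
      ≡⟨ reg x ⟩
    d ∎
    where
    open ≡-Reasoning
    M = +-0-commutativeMonoid

  -- A colour found at a `G`-neighbour `y` of `x` is also found at `π ⟨$⟩ˡ y`, which is a
  -- `G′`-neighbour of `x`.
  permuted-IsRDF : IsRDF k G f → IsRDF k G′ f
  permuted-IsRDF rdf x fx≡⊥ with π , f∘π , G′⇔G ← perm x = ⊆-antisym ⊆⊤ λ {c} _ →
    let y , y∈N , c∈fy = ∈-⋃⁻ f (N G x) (subst (c ∈ˢ_) (sym (rdf x fx≡⊥)) ∈⊤)
        x~y = subst (Adj G x) (sym (inverseʳ π)) (∈N⇒Adj G y∈N)
        fy≡ = trans (cong f (sym (inverseʳ π))) (f∘π (π ⟨$⟩ˡ y))
    in ∈-⋃⁺ f (Adj⇒∈N G′ (Equivalence.from (G′⇔G _) x~y)) (subst (c ∈ˢ_) fy≡ c∈fy)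

∘-transpose : {A : Set} (f : Fin n → A) {i j : Fin n} → f i ≡ f j →
  ∀ y → f (transpose i j y) ≡ f y
∘-transpose f {i} {j} fi≡fj y with y ≟ i
... | yes refl = sym fi≡fj
... | no  _ with y ≟ j
...   | yes refl = fi≡fj
...   | no  _    = refl

-- Edge switching

-- Copies the right-hand side of `IsEdgeSwitch`, so that the specification holds by the identity
-- equivalence.
Switched : Graph n → (u₁ v₁ u₂ v₂ x y : Fin n) → Set
Switched G u₁ v₁ u₂ v₂ x y =
  (Adj G x y ⊎ ⟅ x , y ⟆≡⟅ u₁ , v₂ ⟆ ⊎ ⟅ x , y ⟆≡⟅ u₂ , v₁ ⟆)
  × ¬ ⟅ x , y ⟆≡⟅ u₁ , v₁ ⟆
  × ¬ ⟅ x , y ⟆≡⟅ u₂ , v₂ ⟆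

-- All that switching needs from the colouring to be degree-preserving: the added edges are not
-- loops, are not yet present, and are not among the removed ones.
record Switchable (G : Graph n) (u₁ v₁ u₂ v₂ : Fin n) : Set where
  field
    u₁~v₁ : Adj G u₁ v₁
    u₂~v₂ : Adj G u₂ v₂
    u₁≁v₂ : ¬ Adj G u₁ v₂
    u₂≁v₁ : ¬ Adj G u₂ v₁
    u₁≢u₂ : u₁ ≢ u₂
    v₁≢v₂ : v₁ ≢ v₂
    u₁≢v₂ : u₁ ≢ v₂
    u₂≢v₁ : u₂ ≢ v₁

⟅⟆-sym : {x y a b : Fin n} → ⟅ x , y ⟆≡⟅ a , b ⟆ → ⟅ y , x ⟆≡⟅ a , b ⟆
⟅⟆-sym (inj₁ (p , q)) = inj₂ (q , p)
⟅⟆-sym (inj₂ (p , q)) = inj₁ (q , p)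

⟅⟆? : (x y a b : Fin n) → Dec (⟅ x , y ⟆≡⟅ a , b ⟆)
⟅⟆? x y a b = ((x ≟ a) ×-dec (y ≟ b)) ⊎-dec ((x ≟ b) ×-dec (y ≟ a))

module _ {G : Graph n} where
  open Graph G using (adj?; irrefl) renaming (sym to adj-sym)

  -- Together with `reverse`, this symmetry brings any of the four endpoints into the position of
  -- `u₁`, so only one endpoint has to be analysed.
  exchange : ∀ {u₁ v₁ u₂ v₂} → Switchable G u₁ v₁ u₂ v₂ → Switchable G u₂ v₂ u₁ v₁
  exchange s = record
    { u₁~v₁ = u₂~v₂ ; u₂~v₂ = u₁~v₁ ; u₁≁v₂ = u₂≁v₁ ; u₂≁v₁ = u₁≁v₂
    ; u₁≢u₂ = u₁≢u₂ ∘ sym ; v₁≢v₂ = v₁≢v₂ ∘ sym ; u₁≢v₂ = u₂≢v₁ ; u₂≢v₁ = u₁≢v₂ }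
    where open Switchable s

  reverse : ∀ {u₁ v₁ u₂ v₂} → Switchable G u₁ v₁ u₂ v₂ → Switchable G v₁ u₁ v₂ u₂
  reverse s = record
    { u₁~v₁ = adj-sym u₁~v₁ ; u₂~v₂ = adj-sym u₂~v₂
    ; u₁≁v₂ = u₂≁v₁ ∘ adj-sym ; u₂≁v₁ = u₁≁v₂ ∘ adj-sym
    ; u₁≢u₂ = v₁≢v₂ ; v₁≢v₂ = u₁≢u₂ ; u₁≢v₂ = u₂≢v₁ ∘ sym ; u₂≢v₁ = u₁≢v₂ ∘ sym }
    where open Switchable s

  Switched-exchange : ∀ {u₁ v₁ u₂ v₂ x y} →
    Switched G u₁ v₁ u₂ v₂ x y → Switched G u₂ v₂ u₁ v₁ x y
  Switched-exchange (inj₁ e , p , q) = inj₁ e , q , p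
  Switched-exchange (inj₂ e , p , q) = inj₂ (swap e) , q , p

  Switched-reverse : ∀ {u₁ v₁ u₂ v₂ x y} →
    Switched G u₁ v₁ u₂ v₂ x y → Switched G v₁ u₁ v₂ u₂ x y
  Switched-reverse (e , p , q) = added e , p ∘ swap , q ∘ swap
    where
    added : ∀ {u₁ v₁ u₂ v₂ x y} →
      Adj G x y ⊎ ⟅ x , y ⟆≡⟅ u₁ , v₂ ⟆ ⊎ ⟅ x , y ⟆≡⟅ u₂ , v₁ ⟆ →
      Adj G x y ⊎ ⟅ x , y ⟆≡⟅ v₁ , u₂ ⟆ ⊎ ⟅ x , y ⟆≡⟅ v₂ , u₁ ⟆
    added (inj₁ e)        = inj₁ e
    added (inj₂ (inj₁ e)) = inj₂ (inj₂ (swap e))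
    added (inj₂ (inj₂ e)) = inj₂ (inj₁ (swap e))

  -- Switching trades the neighbour `v₁` of `u₁` for the non-neighbour `v₂` and leaves its other
  -- adjacencies alone.
  Switched-at-endpoint : ∀ {u₁ v₁ u₂ v₂} → Switchable G u₁ v₁ u₂ v₂ →
    ∀ y → Switched G u₁ v₁ u₂ v₂ u₁ y ⇔ Adj G u₁ (transpose v₁ v₂ y)
  -- The case split follows the tests made by `transpose`, which therefore reduces in each branch.
  Switched-at-endpoint {u₁} {v₁} {u₂} {v₂} s y with y ≟ v₁
  ... | yes refl = mk⇔ (λ (_ , p , _) → contradiction (inj₁ (refl , refl)) p)
                       (λ e → contradiction e u₁≁v₂)
    where open Switchable s
  ... | no y≢v₁ with y ≟ v₂
  ...   | yes refl = mk⇔ (λ _ → u₁~v₁) λ _ →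
            inj₂ (inj₁ (inj₁ (refl , refl)))
          , (λ { (inj₁ (_ , y≡v₁)) → y≢v₁ y≡v₁ ; (inj₂ (_ , y≡u₁)) → u₁≢v₂ (sym y≡u₁) })
          , (λ { (inj₁ (u₁≡u₂ , _)) → u₁≢u₂ u₁≡u₂ ; (inj₂ (u₁≡v₂ , _)) → u₁≢v₂ u₁≡v₂ })
    where open Switchable s
  ...   | no y≢v₂ = mk⇔ to λ e → inj₁ e
          , (λ { (inj₁ (_ , y≡v₁)) → y≢v₁ y≡v₁ ; (inj₂ (u₁≡v₁ , _)) → irrefl u₁≡v₁ u₁~v₁ })
          , (λ { (inj₁ (u₁≡u₂ , _)) → u₁≢u₂ u₁≡u₂ ; (inj₂ (u₁≡v₂ , _)) → u₁≢v₂ u₁≡v₂ })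
    where
    open Switchable s
    to : Switched G u₁ v₁ u₂ v₂ u₁ y → Adj G u₁ y
    to (inj₁ e , _)                           = e
    to (inj₂ (inj₁ (inj₁ (_ , y≡v₂))) , _)    = contradiction y≡v₂ y≢v₂
    to (inj₂ (inj₁ (inj₂ (u₁≡v₂ , _))) , _)   = contradiction u₁≡v₂ u₁≢v₂
    to (inj₂ (inj₂ (inj₁ (u₁≡u₂ , _))) , _)   = contradiction u₁≡u₂ u₁≢u₂
    to (inj₂ (inj₂ (inj₂ (u₁≡v₁ , _))) , _)   = contradiction u₁~v₁ (irrefl u₁≡v₁)

  Switched-elsewhere : ∀ {u₁ v₁ u₂ v₂ x} → x ≢ u₁ → x ≢ v₁ → x ≢ u₂ → x ≢ v₂ →
    ∀ y → Switched G u₁ v₁ u₂ v₂ x y ⇔ Adj G x y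
  Switched-elsewhere {u₁} {v₁} {u₂} {v₂} {x} x≢u₁ x≢v₁ x≢u₂ x≢v₂ y =
    mk⇔ to (λ e → inj₁ e , avoids x≢u₁ x≢v₁ , avoids x≢u₂ x≢v₂)
    where
    avoids : ∀ {a b} → x ≢ a → x ≢ b → ¬ ⟅ x , y ⟆≡⟅ a , b ⟆
    avoids x≢a _   (inj₁ (x≡a , _)) = x≢a x≡a
    avoids _   x≢b (inj₂ (x≡b , _)) = x≢b x≡b
    to : Switched G u₁ v₁ u₂ v₂ x y → Adj G x y
    to (inj₁ e , _)        = e
    to (inj₂ (inj₁ e) , _) = contradiction e (avoids x≢u₁ x≢v₂)
    to (inj₂ (inj₂ e) , _) = contradiction e (avoids x≢u₂ x≢v₁)

  switch : ∀ {u₁ v₁ u₂ v₂} → Switchable G u₁ v₁ u₂ v₂ → Graph n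
  switch {u₁} {v₁} {u₂} {v₂} s = record
    { Adj    = Switched G u₁ v₁ u₂ v₂
    ; adj?   = λ x y →
        (adj? x y ⊎-dec (⟅⟆? x y u₁ v₂ ⊎-dec ⟅⟆? x y u₂ v₁))
        ×-dec (¬? (⟅⟆? x y u₁ v₁) ×-dec ¬? (⟅⟆? x y u₂ v₂))
    ; sym    = λ { (e , p , q) → added-sym e , p ∘ ⟅⟆-sym , q ∘ ⟅⟆-sym }
    ; irrefl = λ { refl (e , _) → loopless e }
    }
    where
    open Switchable s
    added-sym : ∀ {x y} →
      Adj G x y ⊎ ⟅ x , y ⟆≡⟅ u₁ , v₂ ⟆ ⊎ ⟅ x , y ⟆≡⟅ u₂ , v₁ ⟆ →
      Adj G y x ⊎ ⟅ y , x ⟆≡⟅ u₁ , v₂ ⟆ ⊎ ⟅ y , x ⟆≡⟅ u₂ , v₁ ⟆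
    added-sym (inj₁ e)        = inj₁ (adj-sym e)
    added-sym (inj₂ (inj₁ e)) = inj₂ (inj₁ (⟅⟆-sym e))
    added-sym (inj₂ (inj₂ e)) = inj₂ (inj₂ (⟅⟆-sym e))
    loopless : ∀ {x} → ¬ (Adj G x x ⊎ ⟅ x , x ⟆≡⟅ u₁ , v₂ ⟆ ⊎ ⟅ x , x ⟆≡⟅ u₂ , v₁ ⟆)
    loopless (inj₁ e)                             = irrefl refl e
    loopless (inj₂ (inj₁ (inj₁ (refl , x≡v₂))))   = u₁≢v₂ x≡v₂
    loopless (inj₂ (inj₁ (inj₂ (refl , x≡u₁))))   = u₁≢v₂ (sym x≡u₁)
    loopless (inj₂ (inj₂ (inj₁ (refl , x≡v₁))))   = u₂≢v₁ x≡v₁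
    loopless (inj₂ (inj₂ (inj₂ (refl , x≡u₂))))   = u₂≢v₁ (sym x≡u₂)

  -- At `u₁` and `u₂` the permutation transposes the `v`s, at `v₁` and `v₂` it transposes the `u`s,
  -- and elsewhere it is the identity; the two equalities of colours make each of these preserve
  -- `f`.
  switch-PermutedN : ∀ {u₁ v₁ u₂ v₂} (s : Switchable G u₁ v₁ u₂ v₂) (f : Coloring n k) →
    f u₁ ≡ f u₂ → f v₁ ≡ f v₂ → PermutedN f G (switch s)
  switch-PermutedN {u₁ = u₁} {v₁} {u₂} {v₂} s f fu≡ fv≡ x
    with x ≟ u₁ | x ≟ v₁ | x ≟ u₂ | x ≟ v₂
  ... | yes refl | _ | _ | _ =
    Perm.transpose v₁ v₂ , ∘-transpose f fv≡ , Switched-at-endpoint s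
  ... | no _ | yes refl | _ | _ =
    Perm.transpose u₁ u₂ , ∘-transpose f fu≡ , λ y →
      Switched-at-endpoint (reverse s) y ⇔-∘ mk⇔ Switched-reverse Switched-reverse
  ... | no _ | no _ | yes refl | _ =
    Perm.transpose v₂ v₁ , ∘-transpose f (sym fv≡) , λ y →
      Switched-at-endpoint (exchange s) y ⇔-∘ mk⇔ Switched-exchange Switched-exchange
  ... | no _ | no _ | no _ | yes refl =
    Perm.transpose u₂ u₁ , ∘-transpose f (sym fu≡) , λ y →
      Switched-at-endpoint (reverse (exchange s)) y
      ⇔-∘ mk⇔ (Switched-reverse ∘ Switched-exchange) (Switched-exchange ∘ Switched-reverse)
  ... | no x≢u₁ | no x≢v₁ | no x≢u₂ | no x≢v₂ =
    Perm.id , (λ _ → refl) , Switched-elsewhere x≢u₁ x≢v₁ x≢u₂ x≢v₂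

-- The condition `u₁ ≢ u₂` makes precise that the edges are two: if `u₁` and `u₂` coincided, the
-- added edges would be the removed ones, and the construction would only delete edges.
proposition2p4 : ∀ {n : ℕ} (d : ℕ) .{{_ : NonZero d}}
    (X : Graph n) → IsRDR d X →
    (f : Coloring n d) → IsRDRColoring d X f →
    (u₁ v₁ u₂ v₂ : Fin n) →
    Adj X u₁ v₁ → Adj X u₂ v₂ → u₁ ≢ u₂ →
    f u₁ ≡ f u₂ → f u₁ ≢ ⊥ →
    (f v₁ ≡ ⊥ × f v₂ ≡ ⊥)
    × (Σ[ X′ ∈ Graph n ]
    IsEdgeSwitch X u₁ v₁ u₂ v₂ X′ × IsRDR d X′ × IsRDRColoring d X′ f)
proposition2p4 d X (reg , _) f (rdf , _ , 2w≡n) u₁ v₁ u₂ v₂ u₁~v₁ u₂~v₂ u₁≢u₂ fu≡ fu₁≢⊥ =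
  (fv₁≡⊥ , fv₂≡⊥) ,
  switch s , (λ _ _ → ⇔-id _) , (reg′ , weight f , γ′ , 2w≡n) , (rdf′ , γ′ , 2w≡n)
  where
  open Tight X f reg rdf 2w≡n
  adj-sym = Graph.sym X

  fu₂≢⊥ : f u₂ ≢ ⊥
  fu₂≢⊥ = fu₁≢⊥ ∘ trans fu≡

  fv₁≡⊥ : f v₁ ≡ ⊥
  fv₁≡⊥ = coloured⇒neighbour-⊥ u₁~v₁ fu₁≢⊥

  fv₂≡⊥ : f v₂ ≡ ⊥
  fv₂≡⊥ = coloured⇒neighbour-⊥ u₂~v₂ fu₂≢⊥

  -- Distinct vertices of the same colour cannot both be seen by a non-coloured one. This yields
  -- both non-adjacencies and `v₁ ≢ v₂`.
  no-common-neighbour : ∀ {v} → f v ≡ ⊥ → Adj X u₁ v → ¬ Adj X u₂ v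
  no-common-neighbour fv≡⊥ u₁~v u₂~v =
    u₁≢u₂ (same-colour-neighbours (adj-sym u₁~v) (adj-sym u₂~v) fv≡⊥ fu≡ fu₁≢⊥)

  s : Switchable X u₁ v₁ u₂ v₂
  s = record
    { u₁~v₁ = u₁~v₁
    ; u₂~v₂ = u₂~v₂
    ; u₁≁v₂ = λ u₁~v₂ → no-common-neighbour fv₂≡⊥ u₁~v₂ u₂~v₂
    ; u₂≁v₁ = no-common-neighbour fv₁≡⊥ u₁~v₁
    ; u₁≢u₂ = u₁≢u₂
    ; v₁≢v₂ = λ { refl → no-common-neighbour fv₁≡⊥ u₁~v₁ u₂~v₂ }
    ; u₁≢v₂ = λ { refl → fu₁≢⊥ fv₂≡⊥ }
    ; u₂≢v₁ = λ { refl → fu₂≢⊥ fv₁≡⊥ }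
    }

  perm : PermutedN f X (switch s)
  perm = switch-PermutedN s f fu≡ (trans fv₁≡⊥ (sym fv₂≡⊥))

  reg′ : Regular d (switch s)
  reg′ = permuted-Regular {G = X} {G′ = switch s} perm reg

  rdf′ : IsRDF d (switch s) f
  rdf′ = permuted-IsRDF {G = X} {G′ = switch s} perm rdf

  γ′ : γ[ d , switch s ]≡ weight f
  γ′ = tight⇒minimal (switch s) f reg′ rdf′ 2w≡n
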